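{- For every positive integer $n$, $$\sum_{r=1}^{n-1}\frac{(-1)^rB_r}{r}\left(\frac{1}{n}\sum_{l=r}^{n}(-1)^l\binom{n}{l}H_{l-1}+\frac{1}{r(n-r)}\right)=\frac{H_{n-1}^{(2)}}{n}+\frac{H_{n-1}}{n^2}.$$
   Context: The Bernoulli numbers $B_n$ are defined by $\sum_{n=0}^\infty \frac{B_n}{n!}t^n=\frac{t}{e^t-1}$ (so $B_1=-\tfrac12$). For $m\ge 0$, $H_m=\sum_{k=1}^m \frac1k$ and $H_m^{(2)}=\sum_{k=1}^m\frac1{k^2}$ (empty sums are $0$, so $H_0=H_0^{(2)}=0$). -}

module Defs where

open import Algebra.Bundles using (CommutativeRing)
open import Data.Fin.Base using (Fin; zero; suc; toℕ)
open import Data.Integer.Base using (+_)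
open import Data.Nat.Base as ℕ using (ℕ; zero; suc; _∸_; _!; NonZero)
open import Data.Nat.Properties using (_!≢0)
open import Data.Rational.Base using (ℚ; 0ℚ; 1ℚ; -_; _+_; _*_; _-_; _/_; toℚᵘ)
open import Data.Rational.Properties using (+-*-commutativeRing; +-*-rawSemiring; +-identityˡ; +-inverseˡ; *-identityˡ; *-identityʳ; *-zeroˡ; *-assoc; toℚᵘ-injective; toℚᵘ-homo-*; toℚᵘ-fromℚᵘ)
import Data.Integer.Properties as ℤ
import Data.Rational.Unnormalised.Base as ℚᵘ
import Data.Rational.Unnormalised.Properties as ℚᵘ
open import Data.Vec.Base using (Vec; []; _∷_; head; lookup)
open import Relation.Binary.PropositionalEquality using (_≡_; _≗_; refl; sym; trans; cong; cong₂; module ≡-Reasoning)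

open import Algebra.Properties.Semiring.Sum (CommutativeRing.semiring +-*-commutativeRing) public using (sum; sum-syntax; sum⁺-syntax; sum-cong-≗)
open import Algebra.Definitions.RawSemiring +-*-rawSemiring public using (_^_)

fromℕ : ℕ → ℚ
fromℕ m = + m / 1

infixl 7 _/ⁿ_

-- Total division by a natural number.  The value at divisor 0 is a dummy: every
-- divisor occurring below and in the theorem is positive.
_/ⁿ_ : ℚ → ℕ → ℚ
x /ⁿ zero  = 0ℚ
x /ⁿ suc m = x * (+ 1 / suc m)

infixl 10 sumFromTo

-- f a + f (a + 1) + ⋯ + f b, which is empty when b < a.
sumFromTo : ℕ → ℕ → (ℕ → ℚ) → ℚ
sumFromTo a b f = ∑[ i < suc b ∸ a ] f (a ℕ.+ toℕ i)

syntax sumFromTo a b (λ k → x) = ∑[ k ∈ a ⋯ b ] x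

H : ℕ → ℚ
H m = ∑[ k ∈ 1 ⋯ m ] (1ℚ /ⁿ k)

H⁽²⁾ : ℕ → ℚ
H⁽²⁾ m = ∑[ k ∈ 1 ⋯ m ] (1ℚ /ⁿ (k ℕ.^ 2))

-- Formal power series over ℚ, given by their coefficients.
Series : Set
Series = ℕ → ℚ

infixl 7 _⊛_

_⊛_ : Series → Series → Series
(f ⊛ g) n = ∑[ k ∈ 0 ⋯ n ] (f k * g (n ∸ k))

oneˢ : Series
oneˢ zero    = 1ℚ
oneˢ (suc _) = 0ℚ

tˢ : Series
tˢ 1 = 1ℚ
tˢ _ = 0ℚ

egf : (ℕ → ℚ) → Series
egf a n = a n /ⁿ (n !)

expˢ : Series
expˢ = egf (λ _ → 1ℚ)

exp-1ˢ : Series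
exp-1ˢ n = expˢ n - oneˢ n

-- invTable e n lists the coefficients of tⁿ, …, t¹, t⁰ in 1 / e, for a series e
-- with constant term 1.
invTable : Series → (n : ℕ) → Vec ℚ (suc n)
invTable e zero    = 1ℚ ∷ []
invTable e (suc n) = - (∑[ i ≤ n ] (e (suc (toℕ i)) * lookup (invTable e n) i)) ∷ invTable e n

inv : Series → Series
inv e n = head (invTable e n)

-- t / (eᵗ - 1) = 1 / ((eᵗ - 1) / t), where division by t shifts the coefficients.
bernoulliSeries : Series
bernoulliSeries = inv (λ n → exp-1ˢ (suc n))

B : ℕ → ℚ
B n = bernoulliSeries n * fromℕ (n !)

private
  lookup-invTable : ∀ e n (i : Fin (suc n)) → lookup (invTable e n) i ≡ inv e (n ∸ toℕ i)
  lookup-invTable e zero    zero    = refl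
  lookup-invTable e (suc n) zero    = refl
  lookup-invTable e (suc n) (suc i) = lookup-invTable e n i

  inv-inverse : ∀ e → e 0 ≡ 1ℚ → e ⊛ inv e ≗ oneˢ
  inv-inverse e e₀≡1 zero rewrite e₀≡1 = refl
  inv-inverse e e₀≡1 (suc n) = begin
    e 0 * - S + ∑[ i ≤ n ] (e (suc (toℕ i)) * inv e (n ∸ toℕ i))
      ≡⟨ cong₂ _+_ (trans (cong (_* - S) e₀≡1) (*-identityˡ (- S)))
                   (sum-cong-≗ {suc n} (λ i → cong (e (suc (toℕ i)) *_) (sym (lookup-invTable e n i)))) ⟩
    - S + S
      ≡⟨ +-inverseˡ S ⟩
    0ℚ ∎
    where
    open ≡-Reasoning
    S : ℚ
    S = ∑[ i ≤ n ] (e (suc (toℕ i)) * lookup (invTable e n) i)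

  fromℕ*1/ : ∀ m → fromℕ (suc m) * (+ 1 / suc m) ≡ 1ℚ
  fromℕ*1/ m = toℚᵘ-injective (begin
    toℚᵘ (fromℕ (suc m) * (+ 1 / suc m))
      ≈⟨ toℚᵘ-homo-* (fromℕ (suc m)) (+ 1 / suc m) ⟩
    toℚᵘ (fromℕ (suc m)) ℚᵘ.* toℚᵘ (+ 1 / suc m)
      ≈⟨ ℚᵘ.*-cong (toℚᵘ-fromℚᵘ (ℚᵘ.mkℚᵘ (+ suc m) 0)) (toℚᵘ-fromℚᵘ (ℚᵘ.mkℚᵘ (+ 1) m)) ⟩
    ℚᵘ.mkℚᵘ (+ suc m) 0 ℚᵘ.* ℚᵘ.mkℚᵘ (+ 1) m
      ≈⟨ ℚᵘ.*≡* (trans (ℤ.*-identityʳ _) (trans (ℤ.*-comm (+ suc m) (+ 1)) (sym (ℤ.*-identityˡ _)))) ⟩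
    ℚᵘ.1ℚᵘ ∎)
    where open ℚᵘ.≃-Reasoning

  *-/ⁿ-cancel : ∀ x m → .{{NonZero m}} → x * fromℕ m /ⁿ m ≡ x
  *-/ⁿ-cancel x (suc m) = trans (*-assoc x (fromℕ (suc m)) (+ 1 / suc m))
    (trans (cong (x *_) (fromℕ*1/ m)) (*-identityʳ x))

-- The defining identity (eᵗ - 1) · ∑ₙ Bₙ tⁿ / n! = t.
B-generating : exp-1ˢ ⊛ egf B ≗ tˢ
B-generating zero    = refl
B-generating (suc n) = begin
  exp-1ˢ 0 * egf B (suc n) + ∑[ i ≤ n ] (e (toℕ i) * egf B (n ∸ toℕ i))
    ≡⟨ cong₂ _+_ (*-zeroˡ (egf B (suc n)))
                 (sum-cong-≗ {suc n} (λ i → cong (e (toℕ i) *_) (egf-B (n ∸ toℕ i)))) ⟩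
  0ℚ + (e ⊛ bernoulliSeries) n
    ≡⟨ +-identityˡ _ ⟩
  (e ⊛ bernoulliSeries) n
    ≡⟨ inv-inverse e refl n ⟩
  oneˢ n
    ≡⟨ oneˢ≡tˢ n ⟩
  tˢ (suc n) ∎
  where
  open ≡-Reasoning
  e : Series
  e k = exp-1ˢ (suc k)
  egf-B : egf B ≗ bernoulliSeries
  egf-B k = *-/ⁿ-cancel (bernoulliSeries k) (k !) {{k !≢0}}
  oneˢ≡tˢ : ∀ k → oneˢ k ≡ tˢ (suc k)
  oneˢ≡tˢ zero    = refl
  oneˢ≡tˢ (suc k) = refl

{-# OPTIONS --safe #-}
-- Write bᵣ = (-1)ʳ Bᵣ and let E be the binomial transform (E a)ₙ = ∑ₖ C(n,k) aₖ.
-- The generating function gives E B = b, that is bₙ = Bₙ + [n = 1].  Since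
-- ∑_{j<m} C(j,r) / (m - j) = C(m,r) (H_m - H_r), the transform of H·B is
-- H_m b_m - ∑_{j<m} b_j / (m - j).  With S(n,r) = ∑_{l=r}^n (-1)ˡ C(n,l) H_{l-1},
-- the difference S(n+1,r) - S(n,r) has a closed form in binomials and H_{r-1}, so
-- ∑_{r≤n} bᵣ S(n,r) / r satisfies a first-order recurrence whose increments are such
-- transforms, up to a telescoping part.  Solving it, all Bernoulli sums cancel except
-- H_{n-1} (bₙ - Bₙ) / n, which is 0 because bₙ = Bₙ unless n = 1, where H₀ = 0.
module Submission where

open import Defs
open import Algebra.Bundles using (CommutativeRing)
open import Data.Fin.Base using (toℕ)
open import Data.Fin.Properties using (toℕ<n)
import Data.Integer.Base as ℤ
import Data.Integer.Properties as ℤ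
open import Data.Nat.Base as ℕ using (ℕ; zero; suc; _∸_; _!; _<_; _≤_; s≤s; z≤n; s≤s⁻¹; NonZero)
import Data.Nat.DivMod as ℕ
import Data.Nat.Induction as ℕ
import Data.Nat.Properties as ℕ
open import Data.Nat.Combinatorics using (_C_; nCn≡1; nC1≡n; nCk≡n!/k![n-k]!; k![n∸k]!∣n!; k>n⇒nCk≡0; nCk+nC[k+1]≡[n+1]C[k+1])
open import Data.Rational.Base using (ℚ; 0ℚ; 1ℚ; -_; _+_; _*_; _-_; _/_; toℚᵘ)
open import Data.Rational.Properties using (+-*-commutativeRing; +-identityˡ; +-identityʳ; +-assoc; +-comm; *-identityˡ; *-identityʳ; *-zeroˡ; *-zeroʳ; *-assoc; *-comm; *-distribʳ-+; toℚᵘ-injective; toℚᵘ-homo-+; toℚᵘ-homo-*; toℚᵘ-fromℚᵘ)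
open import Data.Rational.Solver using (module +-*-Solver)
import Data.Rational.Unnormalised.Base as ℚᵘ
import Data.Rational.Unnormalised.Properties as ℚᵘ
open import Function.Base using (_∘_)
open import Relation.Binary.PropositionalEquality using (_≡_; refl; sym; trans; cong; cong₂; module ≡-Reasoning)
open import Algebra.Properties.Semiring.Sum (CommutativeRing.semiring +-*-commutativeRing) using (∑-distrib-+; ∑-comm; *-distribˡ-sum)
open +-*-Solver using (solve; _:=_; _:+_; _:*_; _:-_; :-_; con)
open ≡-Reasoning

-- Sums over initial segments of ℕ

Σ< : ℕ → (ℕ → ℚ) → ℚ
Σ< n f = ∑[ i < n ] f (toℕ i)

Σ-cong : ∀ n {f g : ℕ → ℚ} → (∀ i → i < n → f i ≡ g i) → Σ< n f ≡ Σ< n g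
Σ-cong n eq = sum-cong-≗ {n} (λ i → eq (toℕ i) (toℕ<n i))

Σ-last : ∀ n f → Σ< (suc n) f ≡ Σ< n f + f n
Σ-last zero    f = +-comm (f 0) 0ℚ
Σ-last (suc n) f = trans (cong (f 0 +_) (Σ-last n (f ∘ suc))) (sym (+-assoc (f 0) _ _))

Σ-+ : ∀ n f g → Σ< n (λ i → f i + g i) ≡ Σ< n f + Σ< n g
Σ-+ n f g = ∑-distrib-+ {n} (f ∘ toℕ) (g ∘ toℕ)

Σ-*ˡ : ∀ n x f → Σ< n (λ i → x * f i) ≡ x * Σ< n f
Σ-*ˡ n x f = sym (*-distribˡ-sum {n} x (f ∘ toℕ))

Σ-- : ∀ n f g → Σ< n (λ i → f i - g i) ≡ Σ< n f - Σ< n g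
Σ-- zero    f g = refl
Σ-- (suc n) f g = trans (cong (f 0 - g 0 +_) (Σ-- n (f ∘ suc) (g ∘ suc)))
  (solve 4 (λ a b u v → (a :- b) :+ (u :- v) := (a :+ u) :- (b :+ v)) refl (f 0) (g 0) _ _)

Σ-zero : ∀ n f → (∀ i → i < n → f i ≡ 0ℚ) → Σ< n f ≡ 0ℚ
Σ-zero zero    f eq = refl
Σ-zero (suc n) f eq = cong₂ _+_ (eq 0 (s≤s z≤n)) (Σ-zero n (f ∘ suc) (λ i i<n → eq (suc i) (s≤s i<n)))

Σ-comm : ∀ m n (f : ℕ → ℕ → ℚ) → Σ< m (λ i → Σ< n (f i)) ≡ Σ< n (λ j → Σ< m (λ i → f i j))
Σ-comm m n f = ∑-comm {m} {n} (λ i j → f (toℕ i) (toℕ j))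

Σ-split : ∀ m n f → Σ< (m ℕ.+ n) f ≡ Σ< m f + Σ< n (λ i → f (m ℕ.+ i))
Σ-split zero    n f = sym (+-identityˡ _)
Σ-split (suc m) n f = trans (cong (f 0 +_) (Σ-split m n (f ∘ suc))) (sym (+-assoc (f 0) _ _))

Σ-reverse : ∀ n f → Σ< (suc n) f ≡ Σ< (suc n) (λ k → f (n ∸ k))
Σ-reverse zero    f = refl
Σ-reverse (suc n) f = begin
  f 0 + Σ< (suc n) (f ∘ suc)
    ≡⟨ cong (f 0 +_) (Σ-reverse n (f ∘ suc)) ⟩
  f 0 + Σ< (suc n) (λ k → f (suc (n ∸ k)))
    ≡⟨ cong (f 0 +_) (Σ-cong (suc n) (λ k k≤n → cong f (sym (ℕ.+-∸-assoc 1 (s≤s⁻¹ k≤n))))) ⟩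
  f 0 + Σ< (suc n) (λ k → f (suc n ∸ k))
    ≡⟨ +-comm (f 0) _ ⟩
  Σ< (suc n) (λ k → f (suc n ∸ k)) + f 0
    ≡⟨ cong (λ j → Σ< (suc n) (λ k → f (suc n ∸ k)) + f j) (ℕ.n∸n≡0 n) ⟨
  Σ< (suc n) (λ k → f (suc n ∸ k)) + f (n ∸ n)
    ≡⟨ Σ-last (suc n) (λ k → f (suc n ∸ k)) ⟨
  Σ< (suc (suc n)) (λ k → f (suc n ∸ k)) ∎

-- Natural numbers and their reciprocals in ℚ

toℚᵘ-fromℕ : ∀ m → toℚᵘ (fromℕ m) ℚᵘ.≃ ℚᵘ.mkℚᵘ (ℤ.+ m) 0
toℚᵘ-fromℕ m = toℚᵘ-fromℚᵘ (ℚᵘ.mkℚᵘ (ℤ.+ m) 0)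

fromℕ-+ : ∀ m n → fromℕ (m ℕ.+ n) ≡ fromℕ m + fromℕ n
fromℕ-+ m n = toℚᵘ-injective (ℚᵘ.≃-trans (toℚᵘ-fromℕ (m ℕ.+ n))
  (ℚᵘ.≃-trans (ℚᵘ.*≡* (cong (ℤ._* (ℤ.+ 1)) (sym (cong₂ ℤ._+_ (ℤ.*-identityʳ (ℤ.+ m)) (ℤ.*-identityʳ (ℤ.+ n))))))
  (ℚᵘ.≃-sym (ℚᵘ.≃-trans (toℚᵘ-homo-+ (fromℕ m) (fromℕ n)) (ℚᵘ.+-cong (toℚᵘ-fromℕ m) (toℚᵘ-fromℕ n))))))

fromℕ-* : ∀ m n → fromℕ (m ℕ.* n) ≡ fromℕ m * fromℕ n
fromℕ-* zero    n = sym (*-zeroˡ (fromℕ n))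
fromℕ-* (suc m) n = begin
  fromℕ (n ℕ.+ m ℕ.* n)             ≡⟨ fromℕ-+ n (m ℕ.* n) ⟩
  fromℕ n + fromℕ (m ℕ.* n)         ≡⟨ cong₂ _+_ (sym (*-identityˡ (fromℕ n))) (fromℕ-* m n) ⟩
  1ℚ * fromℕ n + fromℕ m * fromℕ n  ≡⟨ *-distribʳ-+ (fromℕ n) 1ℚ (fromℕ m) ⟨
  (1ℚ + fromℕ m) * fromℕ n          ≡⟨ cong (_* fromℕ n) (fromℕ-+ 1 m) ⟨
  fromℕ (suc m) * fromℕ n           ∎

-- The dummy value `ι 0` = 0 lets `/ⁿ-ι` and `ι-*` hold without positivity hypotheses.
ι : ℕ → ℚ
ι m = 1ℚ /ⁿ m

/ⁿ-ι : ∀ x m → x /ⁿ m ≡ x * ι m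
/ⁿ-ι x zero    = sym (*-zeroʳ x)
/ⁿ-ι x (suc m) = cong (x *_) (sym (*-identityˡ _))

ι-inverse : ∀ m → .{{NonZero m}} → fromℕ m * ι m ≡ 1ℚ
ι-inverse (suc m) = toℚᵘ-injective (ℚᵘ.≃-trans (toℚᵘ-homo-* (fromℕ (suc m)) (ι (suc m)))
  (ℚᵘ.≃-trans (ℚᵘ.*-cong (toℚᵘ-fromℕ (suc m)) toℚᵘ-ι)
  (ℚᵘ.*≡* (trans (ℤ.*-identityʳ _) (trans (ℤ.*-comm (ℤ.+ suc m) (ℤ.+ 1)) (sym (ℤ.*-identityˡ _)))))))
  where
  toℚᵘ-ι : toℚᵘ (ι (suc m)) ℚᵘ.≃ ℚᵘ.mkℚᵘ (ℤ.+ 1) m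
  toℚᵘ-ι rewrite *-identityˡ (ℤ.+ 1 / suc m) = toℚᵘ-fromℚᵘ (ℚᵘ.mkℚᵘ (ℤ.+ 1) m)

ι-unique : ∀ m x → .{{NonZero m}} → fromℕ m * x ≡ 1ℚ → x ≡ ι m
ι-unique m x mx≡1 = begin
  x                   ≡⟨ *-identityʳ x ⟨
  x * 1ℚ              ≡⟨ cong (x *_) (ι-inverse m) ⟨
  x * (fromℕ m * ι m) ≡⟨ solve 3 (λ x m i → x :* (m :* i) := (m :* x) :* i) refl x (fromℕ m) (ι m) ⟩
  fromℕ m * x * ι m   ≡⟨ cong (_* ι m) mx≡1 ⟩
  1ℚ * ι m            ≡⟨ *-identityˡ (ι m) ⟩
  ι m                 ∎

ι-* : ∀ m n → ι (m ℕ.* n) ≡ ι m * ι n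
ι-* zero    n = sym (*-zeroˡ (ι n))
ι-* (suc m) zero rewrite ℕ.*-zeroʳ m = sym (*-zeroʳ (ι (suc m)))
ι-* (suc m) (suc n) = sym (ι-unique (suc m ℕ.* suc n) (ι (suc m) * ι (suc n)) (begin
  fromℕ (suc m ℕ.* suc n) * (ι (suc m) * ι (suc n))
    ≡⟨ cong (_* (ι (suc m) * ι (suc n))) (fromℕ-* (suc m) (suc n)) ⟩
  fromℕ (suc m) * fromℕ (suc n) * (ι (suc m) * ι (suc n))
    ≡⟨ solve 4 (λ x y i j → x :* y :* (i :* j) := (x :* i) :* (y :* j)) refl (fromℕ (suc m)) (fromℕ (suc n)) (ι (suc m)) (ι (suc n)) ⟩
  (fromℕ (suc m) * ι (suc m)) * (fromℕ (suc n) * ι (suc n))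
    ≡⟨ cong₂ _*_ (ι-inverse (suc m)) (ι-inverse (suc n)) ⟩
  1ℚ ∎))

ι-^2 : ∀ m → ι (m ℕ.^ 2) ≡ ι m * ι m
ι-^2 m = trans (cong (λ k → ι (m ℕ.* k)) (ℕ.*-identityʳ m)) (ι-* m m)

fromℕ-cancelˡ : ∀ m x → .{{NonZero m}} → fromℕ m * x ≡ 0ℚ → x ≡ 0ℚ
fromℕ-cancelˡ m x mx≡0 = begin
  x                   ≡⟨ *-identityˡ x ⟨
  1ℚ * x              ≡⟨ cong (_* x) (ι-inverse m) ⟨
  fromℕ m * ι m * x   ≡⟨ solve 3 (λ m i x → m :* i :* x := i :* (m :* x)) refl (fromℕ m) (ι m) x ⟩
  ι m * (fromℕ m * x) ≡⟨ cong (ι m *_) mx≡0 ⟩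
  ι m * 0ℚ            ≡⟨ *-zeroʳ (ι m) ⟩
  0ℚ                  ∎

-- Partial fractions: over a common denominator the numerator is (i + 1) + (p - i) = p + 1. With r =
-- i + 1 and n = p + 1, the product on the right is 1/(r (n - r)).
ι-+-complement : ∀ {p i} → i < p → ι (suc i) + ι (p ∸ i) ≡ fromℕ (suc p) * (ι (suc i) * ι (p ∸ i))
ι-+-complement {p} {i} i<p = begin
  u + v
    ≡⟨ cong₂ _+_ (trans (sym (*-identityˡ u)) (cong (_* u) (sym (ι-inverse (p ∸ i) {{ℕ.>-nonZero (ℕ.m<n⇒0<n∸m i<p)}}))))
                 (trans (sym (*-identityˡ v)) (cong (_* v) (sym (ι-inverse (suc i))))) ⟩
  y * v * u + x * u * v
    ≡⟨ solve 4 (λ x y u v → y :* v :* u :+ x :* u :* v := (x :+ y) :* (u :* v)) refl x y u v ⟩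
  (x + y) * (u * v)
    ≡⟨ cong (_* (u * v)) (fromℕ-+ (suc i) (p ∸ i)) ⟨
  fromℕ (suc i ℕ.+ (p ∸ i)) * (u * v)
    ≡⟨ cong (λ k → fromℕ (suc k) * (u * v)) (ℕ.m+[n∸m]≡n (ℕ.<⇒≤ i<p)) ⟩
  fromℕ (suc p) * (u * v) ∎
  where
  u v x y : ℚ
  u = ι (suc i)
  v = ι (p ∸ i)
  x = fromℕ (suc i)
  y = fromℕ (p ∸ i)

H-suc : ∀ m → H (suc m) ≡ H m + ι (suc m)
H-suc m = Σ-last m (ι ∘ suc)

-- Binomial coefficients in ℚ

c : ℕ → ℕ → ℚ
c n k = fromℕ (n C k)

c-pascal : ∀ n k → c (suc n) (suc k) ≡ c n k + c n (suc k)
c-pascal n k = trans (cong fromℕ (sym (nCk+nC[k+1]≡[n+1]C[k+1] n k))) (fromℕ-+ (n C k) (n C suc k))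

c-zero : ∀ {n k} → n < k → c n k ≡ 0ℚ
c-zero n<k = cong fromℕ (k>n⇒nCk≡0 n<k)

c-diagonal : ∀ n → c n n ≡ 1ℚ
c-diagonal n = cong fromℕ (nCn≡1 n)

c-0 : ∀ n → c n 0 ≡ 1ℚ
c-0 zero    = refl
c-0 (suc n) = refl

c-subdiagonal : ∀ n → c (suc n) n ≡ fromℕ (suc n)
c-subdiagonal zero    = refl
c-subdiagonal (suc n) = begin
  c (suc (suc n)) (suc n)       ≡⟨ c-pascal (suc n) n ⟩
  c (suc n) n + c (suc n) (suc n) ≡⟨ cong₂ _+_ (c-subdiagonal n) (c-diagonal (suc n)) ⟩
  fromℕ (suc n) + 1ℚ            ≡⟨ +-comm (fromℕ (suc n)) 1ℚ ⟩
  1ℚ + fromℕ (suc n)            ≡⟨ fromℕ-+ 1 (suc n) ⟨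
  fromℕ (suc (suc n))           ∎

c-absorption : ∀ n k → fromℕ (suc n) * c n k ≡ fromℕ (suc k) * c (suc n) (suc k)
c-absorption zero    zero    = refl
c-absorption zero    (suc k) = sym (*-zeroʳ (fromℕ (suc (suc k))))
c-absorption (suc n) zero    = begin
  fromℕ (suc (suc n)) * 1ℚ     ≡⟨ *-comm (fromℕ (suc (suc n))) 1ℚ ⟩
  1ℚ * fromℕ (suc (suc n))     ≡⟨ cong (λ k → 1ℚ * fromℕ k) (nC1≡n (suc (suc n))) ⟨
  1ℚ * c (suc (suc n)) 1       ∎
c-absorption (suc n) (suc k) = begin
  fromℕ (suc (suc n)) * z
    ≡⟨ cong (_* z) (fromℕ-+ 1 (suc n)) ⟩
  (1ℚ + N) * z
    ≡⟨ solve 2 (λ N z → (con 1ℚ :+ N) :* z := z :+ N :* z) refl N z ⟩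
  z + N * z
    ≡⟨ cong (λ t → z + N * t) (c-pascal n k) ⟩
  z + N * (c n k + c n (suc k))
    ≡⟨ solve 4 (λ z N a b → z :+ N :* (a :+ b) := z :+ (N :* a :+ N :* b)) refl z N (c n k) (c n (suc k)) ⟩
  z + (N * c n k + N * c n (suc k))
    ≡⟨ cong (z +_) (cong₂ _+_ (c-absorption n k) (c-absorption n (suc k))) ⟩
  z + (K * z + fromℕ (suc (suc k)) * w)
    ≡⟨ cong (λ t → z + (K * z + t * w)) (fromℕ-+ 1 (suc k)) ⟩
  z + (K * z + (1ℚ + K) * w)
    ≡⟨ solve 3 (λ z K w → z :+ (K :* z :+ (con 1ℚ :+ K) :* w) := (con 1ℚ :+ K) :* (z :+ w)) refl z K w ⟩
  (1ℚ + K) * (z + w)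
    ≡⟨ cong₂ _*_ (fromℕ-+ 1 (suc k)) (c-pascal (suc n) (suc k)) ⟨
  fromℕ (suc (suc k)) * c (suc (suc n)) (suc (suc k)) ∎
  where
  N K z w : ℚ
  N = fromℕ (suc n)
  K = fromℕ (suc k)
  z = c (suc n) (suc k)
  w = c (suc n) (suc (suc k))

-- Trades the weight 1/(k + 1), which varies under a sum over k, for the constant weight 1/(n + 1).
c-absorption-ι : ∀ n k → ι (suc k) * c n k ≡ ι (suc n) * c (suc n) (suc k)
c-absorption-ι n k = begin
  i * c n k                ≡⟨ trans (sym (*-identityˡ _)) (cong (_* (i * c n k)) (sym (ι-inverse (suc n)))) ⟩
  N * j * (i * c n k)      ≡⟨ solve 4 (λ N j i z → N :* j :* (i :* z) := j :* i :* (N :* z)) refl N j i (c n k) ⟩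
  j * i * (N * c n k)      ≡⟨ cong (j * i *_) (c-absorption n k) ⟩
  j * i * (K * z)          ≡⟨ solve 4 (λ j i K z → j :* i :* (K :* z) := K :* i :* (j :* z)) refl j i K z ⟩
  K * i * (j * z)          ≡⟨ cong (_* (j * z)) (ι-inverse (suc k)) ⟩
  1ℚ * (j * z)             ≡⟨ *-identityˡ _ ⟩
  j * z                    ∎
  where
  N K i j z : ℚ
  N = fromℕ (suc n)
  K = fromℕ (suc k)
  i = ι (suc k)
  j = ι (suc n)
  z = c (suc n) (suc k)

-- In this form `n !` leaves a sum over k, while the two reciprocals are coefficients of exponential
-- generating functions: a binomial sum becomes a Cauchy product.
c-factorial : ∀ {n k} → k ≤ n → c n k ≡ fromℕ (n !) * (ι ((n ∸ k) !) * ι (k !))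
c-factorial {n} {k} k≤n = begin
  c n k                          ≡⟨ *-identityʳ _ ⟨
  c n k * 1ℚ                     ≡⟨ cong (c n k *_) (ι-inverse d {{k!*n∸k!}}) ⟨
  c n k * (fromℕ d * ι d)        ≡⟨ *-assoc (c n k) (fromℕ d) (ι d) ⟨
  c n k * fromℕ d * ι d          ≡⟨ cong (_* ι d) (fromℕ-* (n C k) d) ⟨
  fromℕ ((n C k) ℕ.* d) * ι d      ≡⟨ cong (λ m → fromℕ m * ι d) nCk*d≡n! ⟩
  fromℕ (n !) * ι d              ≡⟨ cong (fromℕ (n !) *_) (trans (ι-* (k !) ((n ∸ k) !)) (*-comm (ι (k !)) _)) ⟩
  fromℕ (n !) * (ι ((n ∸ k) !) * ι (k !)) ∎
  where
  d : ℕ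
  d = k ! ℕ.* (n ∸ k) !
  k!*n∸k! : NonZero d
  k!*n∸k! = ℕ._!*_!≢0 k (n ∸ k)
  nCk*d≡n! : (n C k) ℕ.* d ≡ n !
  nCk*d≡n! = trans (cong (ℕ._* d) (nCk≡n!/k![n-k]! k≤n)) (ℕ.m/n*n≡m {{k!*n∸k!}} (k![n∸k]!∣n! k≤n))

-- The binomial transform

E : (ℕ → ℚ) → ℕ → ℚ
E a n = Σ< (suc n) (λ k → c n k * a k)

E-cong : ∀ {a b : ℕ → ℚ} → (∀ k → a k ≡ b k) → ∀ n → E a n ≡ E b n
E-cong a≗b n = Σ-cong (suc n) (λ k _ → cong (c n k *_) (a≗b k))

E-+ : ∀ a b n → E (λ k → a k + b k) n ≡ E a n + E b n
E-+ a b n = trans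
  (Σ-cong (suc n) (λ k _ → solve 3 (λ z x y → z :* (x :+ y) := z :* x :+ z :* y) refl (c n k) (a k) (b k)))
  (Σ-+ (suc n) (λ k → c n k * a k) (λ k → c n k * b k))

E-- : ∀ a b n → E (λ k → a k - b k) n ≡ E a n - E b n
E-- a b n = trans
  (Σ-cong (suc n) (λ k _ → solve 3 (λ z x y → z :* (x :- y) := z :* x :- z :* y) refl (c n k) (a k) (b k)))
  (Σ-- (suc n) (λ k → c n k * a k) (λ k → c n k * b k))

E-*ˡ : ∀ x a n → E (λ k → x * a k) n ≡ x * E a n
E-*ˡ x a n = trans
  (Σ-cong (suc n) (λ k _ → solve 3 (λ z x y → z :* (x :* y) := x :* (z :* y)) refl (c n k) x (a k)))
  (Σ-*ˡ (suc n) x (λ k → c n k * a k))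

-- The added terms carry C(n,k) with k > n. A range independent of n is needed to compare or
-- exchange sums of transforms.
E-extend : ∀ {N n} a → n < N → Σ< N (λ k → c n k * a k) ≡ E a n
E-extend {N} {n} a n<N = begin
  Σ< N f
    ≡⟨ cong (λ M → Σ< M f) (ℕ.m+[n∸m]≡n n<N) ⟨
  Σ< (suc n ℕ.+ (N ∸ suc n)) f
    ≡⟨ Σ-split (suc n) (N ∸ suc n) f ⟩
  E a n + Σ< (N ∸ suc n) (λ i → f (suc n ℕ.+ i))
    ≡⟨ cong (λ t → E a n + t) (Σ-zero (N ∸ suc n) _ (λ i _ →
         trans (cong (_* a (suc n ℕ.+ i)) (c-zero (s≤s (ℕ.m≤m+n n i)))) (*-zeroˡ (a (suc n ℕ.+ i))))) ⟩
  E a n + 0ℚ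
    ≡⟨ +-identityʳ _ ⟩
  E a n ∎
  where
  f : ℕ → ℚ
  f k = c n k * a k

-- Pascal's rule under the sum. It allows induction on n with the sequence generalised to its shift.
E-suc : ∀ a n → E a (suc n) ≡ E a n + E (a ∘ suc) n
E-suc a n = begin
  c (suc n) 0 * a 0 + Σ< (suc n) (λ k → c (suc n) (suc k) * a (suc k))
    ≡⟨ cong₂ _+_ (cong (_* a 0) (trans (c-0 (suc n)) (sym (c-0 n))))
                 (Σ-cong (suc n) (λ k _ → trans (cong (_* a (suc k)) (c-pascal n k)) (*-distribʳ-+ (a (suc k)) (c n k) (c n (suc k))))) ⟩
  c n 0 * a 0 + Σ< (suc n) (λ k → c n k * a (suc k) + c n (suc k) * a (suc k))
    ≡⟨ cong (λ t → c n 0 * a 0 + t) (Σ-+ (suc n) (λ k → c n k * a (suc k)) (λ k → c n (suc k) * a (suc k))) ⟩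
  c n 0 * a 0 + (E (a ∘ suc) n + Σ< (suc n) (λ k → c n (suc k) * a (suc k)))
    ≡⟨ solve 3 (λ x y z → x :+ (y :+ z) := (x :+ z) :+ y) refl (c n 0 * a 0) (E (a ∘ suc) n) _ ⟩
  Σ< (suc (suc n)) (λ k → c n k * a k) + E (a ∘ suc) n
    ≡⟨ cong (_+ E (a ∘ suc) n) (E-extend a (ℕ.m<n⇒m<1+n (ℕ.n<1+n n))) ⟩
  E a n + E (a ∘ suc) n ∎

-- Signs, binomial inversion and fixed points of the transform

sg : ℕ → ℚ
sg n = (- 1ℚ) ^ n

sg*sg : ∀ n → sg n * sg n ≡ 1ℚ
sg*sg zero    = refl
sg*sg (suc n) = trans (solve 1 (λ s → con (- 1ℚ) :* s :* (con (- 1ℚ) :* s) := s :* s) refl (sg n)) (sg*sg n)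

-- E ∘ N ∘ E = N for the sign change N, which is binomial inversion.
E-signed-involutive : ∀ n a → E (λ k → sg k * E a k) n ≡ sg n * a n
E-signed-involutive zero    a =
  solve 1 (λ x → con 1ℚ :* (con 1ℚ :* (con 1ℚ :* x :+ con 0ℚ)) :+ con 0ℚ := con 1ℚ :* x) refl (a 0)
E-signed-involutive (suc n) a = begin
  E g (suc n)
    ≡⟨ E-suc g n ⟩
  E g n + E (g ∘ suc) n
    ≡⟨ cong (E g n +_) (E-cong (λ k → trans (cong (sg (suc k) *_) (E-suc a k))
         (solve 3 (λ s x y → con (- 1ℚ) :* s :* (x :+ y) := con (- 1ℚ) :* (s :* x :+ s :* y)) refl (sg k) (E a k) (E (a ∘ suc) k))) n) ⟩
  E g n + E (λ k → - 1ℚ * (g k + g′ k)) n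
    ≡⟨ cong (E g n +_) (trans (E-*ˡ (- 1ℚ) (λ k → g k + g′ k) n) (cong (- 1ℚ *_) (E-+ g g′ n))) ⟩
  E g n + - 1ℚ * (E g n + E g′ n)
    ≡⟨ cong (λ t → E g n + - 1ℚ * (E g n + t)) (E-signed-involutive n (a ∘ suc)) ⟩
  E g n + - 1ℚ * (E g n + sg n * a (suc n))
    ≡⟨ solve 3 (λ x s y → x :+ con (- 1ℚ) :* (x :+ s :* y) := con (- 1ℚ) :* s :* y) refl (E g n) (sg n) (a (suc n)) ⟩
  sg (suc n) * a (suc n) ∎
  where
  g g′ : ℕ → ℚ
  g  k = sg k * E a k
  g′ k = sg k * E (a ∘ suc) k

-- In the equation at n + 1 the top term of the transform is `d (suc n)` itself and cancels. The
-- lower terms vanish by strong induction except (n + 1) `d n`, which must therefore be 0.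
E-fixed⇒zero : ∀ d → (∀ n → E d n ≡ d n) → ∀ n → d n ≡ 0ℚ
E-fixed⇒zero d fixed = ℕ.<-rec (λ n → d n ≡ 0ℚ) step
  where
  step : ∀ n → (∀ {k} → k < n → d k ≡ 0ℚ) → d n ≡ 0ℚ
  step n ih = fromℕ-cancelˡ (suc n) (d n) (begin
    fromℕ (suc n) * d n
      ≡⟨ cong (_* d n) (c-subdiagonal n) ⟨
    f n
      ≡⟨ +-identityˡ _ ⟨
    0ℚ + f n
      ≡⟨ cong (_+ f n) (Σ-zero n f (λ k k<n → trans (cong (c (suc n) k *_) (ih k<n)) (*-zeroʳ (c (suc n) k)))) ⟨
    Σ< n f + f n
      ≡⟨ Σ-last n f ⟨
    Σ< (suc n) f
      ≡⟨ solve 2 (λ x y → x := x :+ con 1ℚ :* y :- y) refl (Σ< (suc n) f) (d (suc n)) ⟩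
    Σ< (suc n) f + 1ℚ * d (suc n) - d (suc n)
      ≡⟨ cong (λ t → Σ< (suc n) f + t * d (suc n) - d (suc n)) (c-diagonal (suc n)) ⟨
    Σ< (suc n) f + f (suc n) - d (suc n)
      ≡⟨ cong (_- d (suc n)) (Σ-last (suc n) f) ⟨
    E d (suc n) - d (suc n)
      ≡⟨ cong (_- d (suc n)) (fixed (suc n)) ⟩
    d (suc n) - d (suc n)
      ≡⟨ solve 1 (λ x → x :- x := con 0ℚ) refl (d (suc n)) ⟩
    0ℚ ∎)
    where
    f : ℕ → ℚ
    f k = c (suc n) k * d k

-- Bernoulli numbers

-- This is n! times the coefficient of tⁿ in the defining identity, read as eᵗ · `egf B` = `egf B` +
-- t. The auxiliary `g` accounts for the 1 subtracted in eᵗ - 1; only its term at k = n survives,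
-- and it equals `B n`.
E-B : ∀ n → E B n ≡ B n + tˢ n
E-B n = begin
  E B n
    ≡⟨ solve 2 (λ x y → x := y :+ (x :- y)) refl (E B n) (B n) ⟩
  B n + (E B n - B n)
    ≡⟨ cong (λ t → B n + (E B n - t)) (sym Σ-one) ⟩
  B n + (E B n - Σ< (suc n) g)
    ≡⟨ cong (B n +_) (Σ-- (suc n) (λ k → c n k * B k) g) ⟨
  B n + Σ< (suc n) (λ k → c n k * B k - g k)
    ≡⟨ cong (B n +_) (Σ-cong (suc n) (λ k k≤n → term k (s≤s⁻¹ k≤n))) ⟩
  B n + Σ< (suc n) (λ k → fromℕ (n !) * (exp-1ˢ (n ∸ k) * egf B (n ∸ (n ∸ k))))
    ≡⟨ cong (B n +_) (Σ-*ˡ (suc n) (fromℕ (n !)) (λ k → exp-1ˢ (n ∸ k) * egf B (n ∸ (n ∸ k)))) ⟩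
  B n + fromℕ (n !) * Σ< (suc n) (λ k → exp-1ˢ (n ∸ k) * egf B (n ∸ (n ∸ k)))
    ≡⟨ cong (λ t → B n + fromℕ (n !) * t) (Σ-reverse n (λ k → exp-1ˢ k * egf B (n ∸ k))) ⟨
  B n + fromℕ (n !) * (exp-1ˢ ⊛ egf B) n
    ≡⟨ cong (λ t → B n + fromℕ (n !) * t) (B-generating n) ⟩
  B n + fromℕ (n !) * tˢ n
    ≡⟨ cong (B n +_) (n!*tˢ n) ⟩
  B n + tˢ n ∎
  where
  g h : ℕ → ℚ
  h k = fromℕ (n !) * ι (k !) * B k
  g k = oneˢ (n ∸ k) * h k

  n!*tˢ : ∀ m → fromℕ (m !) * tˢ m ≡ tˢ m
  n!*tˢ 0 = refl
  n!*tˢ 1 = refl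
  n!*tˢ (suc (suc m)) = *-zeroʳ (fromℕ (suc (suc m) !))

  oneˢ-positive : ∀ m → 0 < m → oneˢ m ≡ 0ℚ
  oneˢ-positive (suc m) _ = refl

  Σ-one : Σ< (suc n) g ≡ B n
  Σ-one = begin
    Σ< (suc n) g
      ≡⟨ Σ-last n g ⟩
    Σ< n g + g n
      ≡⟨ cong₂ _+_ (Σ-zero n g (λ k k<n → trans (cong (_* h k) (oneˢ-positive (n ∸ k) (ℕ.m<n⇒0<n∸m k<n))) (*-zeroˡ (h k))))
                   (cong₂ _*_ (cong oneˢ (ℕ.n∸n≡0 n)) (cong (_* B n) (ι-inverse (n !) {{n ℕ.!≢0}}))) ⟩
    0ℚ + 1ℚ * (1ℚ * B n)
      ≡⟨ solve 1 (λ x → con 0ℚ :+ con 1ℚ :* (con 1ℚ :* x) := x) refl (B n) ⟩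
    B n ∎

  term : ∀ k → k ≤ n → c n k * B k - g k ≡ fromℕ (n !) * (exp-1ˢ (n ∸ k) * egf B (n ∸ (n ∸ k)))
  term k k≤n = begin
    c n k * B k - g k
      ≡⟨ cong (λ t → t * B k - g k) (c-factorial k≤n) ⟩
    fromℕ (n !) * (ι ((n ∸ k) !) * ι (k !)) * B k - oneˢ (n ∸ k) * (fromℕ (n !) * ι (k !) * B k)
      ≡⟨ solve 5 (λ N e o i b → N :* (e :* i) :* b :- o :* (N :* i :* b) := N :* ((e :- o) :* (b :* i))) refl
           (fromℕ (n !)) (ι ((n ∸ k) !)) (oneˢ (n ∸ k)) (ι (k !)) (B k) ⟩
    fromℕ (n !) * (exp-1ˢ (n ∸ k) * (B k * ι (k !)))
      ≡⟨ cong (λ t → fromℕ (n !) * (exp-1ˢ (n ∸ k) * t)) (/ⁿ-ι (B k) (k !)) ⟨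
    fromℕ (n !) * (exp-1ˢ (n ∸ k) * egf B k)
      ≡⟨ cong (λ j → fromℕ (n !) * (exp-1ˢ (n ∸ k) * egf B j)) (ℕ.m∸[m∸n]≡n k≤n) ⟨
    fromℕ (n !) * (exp-1ˢ (n ∸ k) * egf B (n ∸ (n ∸ k))) ∎

-- The Bernoulli numbers in the other convention, with b₁ = +1/2.
b : ℕ → ℚ
b n = sg n * B n

-- With N the sign change, E B = B + t and E N E = N make N B - t - B a fixed point of E.
b≡B+t : ∀ n → b n ≡ B n + tˢ n
b≡B+t n = begin
  b n                                  ≡⟨ solve 3 (λ x y z → x := x :- y :- z :+ (z :+ y)) refl (b n) (tˢ n) (B n) ⟩
  (b n - tˢ n - B n) + (B n + tˢ n)    ≡⟨ cong (_+ (B n + tˢ n)) (E-fixed⇒zero d d-fixed n) ⟩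
  0ℚ + (B n + tˢ n)                    ≡⟨ +-identityˡ _ ⟩
  B n + tˢ n                           ∎
  where
  d : ℕ → ℚ
  d k = b k - tˢ k - B k

  sg*tˢ : ∀ k → sg k * tˢ k ≡ - tˢ k
  sg*tˢ 0 = refl
  sg*tˢ 1 = refl
  sg*tˢ (suc (suc k)) = *-zeroʳ (sg (suc (suc k)))

  signed : ∀ k → sg k * E B k ≡ b k - tˢ k
  signed k = begin
    sg k * E B k            ≡⟨ cong (sg k *_) (E-B k) ⟩
    sg k * (B k + tˢ k)     ≡⟨ solve 3 (λ s x y → s :* (x :+ y) := s :* x :+ s :* y) refl (sg k) (B k) (tˢ k) ⟩
    b k + sg k * tˢ k       ≡⟨ cong (b k +_) (sg*tˢ k) ⟩
    b k - tˢ k              ∎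

  d-fixed : ∀ m → E d m ≡ d m
  d-fixed m = begin
    E d m
      ≡⟨ E-- (λ k → b k - tˢ k) B m ⟩
    E (λ k → b k - tˢ k) m - E B m
      ≡⟨ cong₂ _-_ (trans (E-cong (sym ∘ signed) m) (E-signed-involutive m B)) (E-B m) ⟩
    b m - (B m + tˢ m)
      ≡⟨ solve 3 (λ x y z → x :- (z :+ y) := x :- y :- z) refl (b m) (tˢ m) (B m) ⟩
    d m ∎

E-B≡b : ∀ n → E B n ≡ b n
E-B≡b n = trans (E-B n) (sym (b≡B+t n))

-- The transform `E B m` without its term at k = 0, which is `B 0` = 1.
Σ-cB : ∀ m → Σ< m (λ r → c m (suc r) * B (suc r)) ≡ b m - 1ℚ
Σ-cB m = begin
  S                       ≡⟨ solve 1 (λ x → x := con 1ℚ :* con 1ℚ :+ x :- con 1ℚ) refl S ⟩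
  1ℚ * 1ℚ + S - 1ℚ        ≡⟨ cong (λ t → t * 1ℚ + S - 1ℚ) (c-0 m) ⟨
  E B m - 1ℚ              ≡⟨ cong (_- 1ℚ) (E-B≡b m) ⟩
  b m - 1ℚ                ∎
  where
  S : ℚ
  S = Σ< m (λ r → c m (suc r) * B (suc r))

-- Harmonic numbers and the binomial transform

-- Induction on m, splitting C(j + 1,r + 1) by Pascal's rule. Passing from `H r` to `H (suc r)`
-- leaves a surplus C(m,r)/(r + 1); absorption makes it C(m + 1,r + 1)/(m + 1), exactly the
-- increment from `H m` to `H (suc m)`.
harmonic-convolution : ∀ m r → Σ< m (λ j → ι (m ∸ j) * c j r) ≡ c m r * (H m - H r)
harmonic-convolution zero    zero    = refl
harmonic-convolution zero    (suc r) = sym (*-zeroˡ (H 0 - H (suc r)))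
harmonic-convolution (suc m) zero    = begin
  ι (suc m) * 1ℚ + Σ< m (λ j → ι (m ∸ j) * c (suc j) 0)
    ≡⟨ cong (ι (suc m) * 1ℚ +_) (Σ-cong m (λ j _ → cong (ι (m ∸ j) *_) (sym (c-0 j)))) ⟩
  ι (suc m) * 1ℚ + Σ< m (λ j → ι (m ∸ j) * c j 0)
    ≡⟨ cong (ι (suc m) * 1ℚ +_) (trans (harmonic-convolution m zero) (cong (_* (H m - 0ℚ)) (c-0 m))) ⟩
  ι (suc m) * 1ℚ + 1ℚ * (H m - 0ℚ)
    ≡⟨ solve 2 (λ i h → i :* con 1ℚ :+ con 1ℚ :* (h :- con 0ℚ) := con 1ℚ :* (h :+ i :- con 0ℚ)) refl (ι (suc m)) (H m) ⟩
  1ℚ * (H m + ι (suc m) - 0ℚ)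
    ≡⟨ cong (λ t → 1ℚ * (t - 0ℚ)) (H-suc m) ⟨
  1ℚ * (H (suc m) - 0ℚ) ∎
harmonic-convolution (suc m) (suc r) = begin
  ι (suc m) * 0ℚ + Σ< m (λ j → ι (m ∸ j) * c (suc j) (suc r))
    ≡⟨ cong (ι (suc m) * 0ℚ +_) (Σ-cong m (λ j _ → trans (cong (ι (m ∸ j) *_) (c-pascal j r))
         (solve 3 (λ i x y → i :* (x :+ y) := i :* x :+ i :* y) refl (ι (m ∸ j)) (c j r) (c j (suc r))))) ⟩
  ι (suc m) * 0ℚ + Σ< m (λ j → ι (m ∸ j) * c j r + ι (m ∸ j) * c j (suc r))
    ≡⟨ cong (ι (suc m) * 0ℚ +_) (trans (Σ-+ m (λ j → ι (m ∸ j) * c j r) (λ j → ι (m ∸ j) * c j (suc r)))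
         (cong₂ _+_ (harmonic-convolution m r) (harmonic-convolution m (suc r)))) ⟩
  ι (suc m) * 0ℚ + (x * (H m - H r) + y * (H m - H (suc r)))
    ≡⟨ cong (λ t → ι (suc m) * 0ℚ + (x * (H m - H r) + y * (H m - t))) (H-suc r) ⟩
  ι (suc m) * 0ℚ + (x * (H m - H r) + y * (H m - (H r + ι (suc r))))
    ≡⟨ solve 6 (λ i j x y h g → i :* con 0ℚ :+ (x :* (h :- g) :+ y :* (h :- (g :+ j)))
                             := (x :+ y) :* (h :- (g :+ j)) :+ j :* x) refl (ι (suc m)) (ι (suc r)) x y (H m) (H r) ⟩
  (x + y) * (H m - (H r + ι (suc r))) + ι (suc r) * x
    ≡⟨ cong₂ _+_ (cong (_* (H m - (H r + ι (suc r)))) (sym (c-pascal m r))) (c-absorption-ι m r) ⟩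
  z * (H m - (H r + ι (suc r))) + ι (suc m) * z
    ≡⟨ solve 5 (λ i j z h g → z :* (h :- (g :+ j)) :+ i :* z := z :* ((h :+ i) :- (g :+ j))) refl (ι (suc m)) (ι (suc r)) z (H m) (H r) ⟩
  z * ((H m + ι (suc m)) - (H r + ι (suc r)))
    ≡⟨ cong₂ (λ s t → z * (s - t)) (H-suc m) (H-suc r) ⟨
  z * (H (suc m) - H (suc r)) ∎
  where
  x y z : ℚ
  x = c m r
  y = c m (suc r)
  z = c (suc m) (suc r)

-- Write H_r = H_m - (H_m - H_r). By `harmonic-convolution` the weight C(m,r) (H_m - H_r) is a sum
-- over j < m, and exchanging the sums produces the transforms `E a j`.
E-H : ∀ a m → E (λ r → H r * a r) m ≡ H m * E a m - Σ< m (λ j → ι (m ∸ j) * E a j)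
E-H a m = begin
  E (λ r → H r * a r) m
    ≡⟨ E-cong (λ r → solve 3 (λ h k x → k :* x := h :* x :- (h :- k) :* x) refl (H m) (H r) (a r)) m ⟩
  E (λ r → H m * a r - (H m - H r) * a r) m
    ≡⟨ trans (E-- (λ r → H m * a r) (λ r → (H m - H r) * a r) m) (cong (_- E (λ r → (H m - H r) * a r) m) (E-*ˡ (H m) a m)) ⟩
  H m * E a m - E (λ r → (H m - H r) * a r) m
    ≡⟨ cong (λ t → H m * E a m - t) convolution ⟨
  H m * E a m - Σ< m (λ j → ι (m ∸ j) * E a j) ∎
  where
  convolution : Σ< m (λ j → ι (m ∸ j) * E a j) ≡ E (λ r → (H m - H r) * a r) m
  convolution = begin
    Σ< m (λ j → ι (m ∸ j) * E a j)
      ≡⟨ Σ-cong m (λ j j<m → trans (cong (ι (m ∸ j) *_) (sym (E-extend a (ℕ.m<n⇒m<1+n j<m))))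
           (sym (Σ-*ˡ (suc m) (ι (m ∸ j)) (λ r → c j r * a r)))) ⟩
    Σ< m (λ j → Σ< (suc m) (λ r → ι (m ∸ j) * (c j r * a r)))
      ≡⟨ Σ-comm m (suc m) (λ j r → ι (m ∸ j) * (c j r * a r)) ⟩
    Σ< (suc m) (λ r → Σ< m (λ j → ι (m ∸ j) * (c j r * a r)))
      ≡⟨ Σ-cong (suc m) (λ r _ → inner r) ⟩
    E (λ r → (H m - H r) * a r) m ∎
    where
    inner : ∀ r → Σ< m (λ j → ι (m ∸ j) * (c j r * a r)) ≡ c m r * ((H m - H r) * a r)
    inner r = begin
      Σ< m (λ j → ι (m ∸ j) * (c j r * a r))
        ≡⟨ Σ-cong m (λ j _ → solve 3 (λ i z x → i :* (z :* x) := x :* (i :* z)) refl (ι (m ∸ j)) (c j r) (a r)) ⟩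
      Σ< m (λ j → a r * (ι (m ∸ j) * c j r))
        ≡⟨ Σ-*ˡ m (a r) (λ j → ι (m ∸ j) * c j r) ⟩
      a r * Σ< m (λ j → ι (m ∸ j) * c j r)
        ≡⟨ cong (a r *_) (harmonic-convolution m r) ⟩
      a r * (c m r * (H m - H r))
        ≡⟨ solve 3 (λ x z h → x :* (z :* h) := z :* (h :* x)) refl (a r) (c m r) (H m - H r) ⟩
      c m r * ((H m - H r) * a r) ∎

-- Closed forms of binomially weighted Bernoulli sums

V : ℕ → ℚ
V m = Σ< m (λ r → ι (suc r) * (c m (suc r) * B (suc r)))

-- Pascal's rule and absorption give V(m + 1) = V(m) + (1/(m + 1)) ∑ C(m + 1,r) B_r over 1 ≤ r ≤ m +
-- 1, and `Σ-cB` evaluates the last sum.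
V-closed : ∀ m → V m ≡ Σ< m (λ j → ι (suc j) * (b (suc j) - 1ℚ))
V-closed zero    = refl
V-closed (suc m) = begin
  V (suc m)
    ≡⟨ Σ-cong (suc m) (λ r _ → term r) ⟩
  Σ< (suc m) (λ r → ι (suc m) * (c (suc m) (suc r) * B (suc r)) + v r)
    ≡⟨ Σ-+ (suc m) (λ r → ι (suc m) * (c (suc m) (suc r) * B (suc r))) v ⟩
  Σ< (suc m) (λ r → ι (suc m) * (c (suc m) (suc r) * B (suc r))) + Σ< (suc m) v
    ≡⟨ cong₂ _+_ (trans (Σ-*ˡ (suc m) (ι (suc m)) (λ r → c (suc m) (suc r) * B (suc r))) (cong (ι (suc m) *_) (Σ-cB (suc m)))) Σv ⟩
  w m + V m
    ≡⟨ trans (+-comm (w m) (V m)) (cong (_+ w m) (V-closed m)) ⟩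
  Σ< m w + w m
    ≡⟨ Σ-last m w ⟨
  Σ< (suc m) w ∎
  where
  v w : ℕ → ℚ
  v r = ι (suc r) * (c m (suc r) * B (suc r))
  w j = ι (suc j) * (b (suc j) - 1ℚ)

  term : ∀ r → ι (suc r) * (c (suc m) (suc r) * B (suc r)) ≡ ι (suc m) * (c (suc m) (suc r) * B (suc r)) + v r
  term r = begin
    ι (suc r) * (c (suc m) (suc r) * B (suc r))
      ≡⟨ cong (λ t → ι (suc r) * (t * B (suc r))) (c-pascal m r) ⟩
    ι (suc r) * ((c m r + c m (suc r)) * B (suc r))
      ≡⟨ solve 4 (λ i x y z → i :* ((x :+ y) :* z) := i :* x :* z :+ i :* (y :* z)) refl (ι (suc r)) (c m r) (c m (suc r)) (B (suc r)) ⟩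
    ι (suc r) * c m r * B (suc r) + v r
      ≡⟨ cong (λ t → t * B (suc r) + v r) (c-absorption-ι m r) ⟩
    ι (suc m) * c (suc m) (suc r) * B (suc r) + v r
      ≡⟨ cong (_+ v r) (*-assoc (ι (suc m)) (c (suc m) (suc r)) (B (suc r))) ⟩
    ι (suc m) * (c (suc m) (suc r) * B (suc r)) + v r ∎

  Σv : Σ< (suc m) v ≡ V m
  Σv = begin
    Σ< (suc m) v
      ≡⟨ Σ-last m v ⟩
    V m + ι (suc m) * (c m (suc m) * B (suc m))
      ≡⟨ cong (λ t → V m + ι (suc m) * (t * B (suc m))) (c-zero (ℕ.n<1+n m)) ⟩
    V m + ι (suc m) * (0ℚ * B (suc m))
      ≡⟨ solve 3 (λ v i z → v :+ i :* (con 0ℚ :* z) := v) refl (V m) (ι (suc m)) (B (suc m)) ⟩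
    V m ∎

u : ℕ → ℕ → ℚ
u m r = c m (suc r) * (B (suc r) * H r)

U : ℕ → ℚ
U m = Σ< m (u m)

-- With n = p + 1 and r = i + 1 this is the sum of b_r / (r (n - r)) over 0 < r < n.
W : ℕ → ℚ
W p = Σ< p (λ i → ι (suc i) * ι (p ∸ i) * b (suc i))

-- Since H_{r-1} = H_r - 1/r, the sum is the transform of H·B minus `V`. After `E-H` and `V-closed`
-- the sums of b_r / (n - r) and b_r / r remain, and partial fractions merge them into n times
-- `W p`.
U-closed : ∀ p → U (suc p) ≡ H p * (b (suc p) + 1ℚ) - fromℕ (suc p) * W p
U-closed p = begin
  U m
    ≡⟨ Σ-cong m (λ r _ → term r) ⟩
  Σ< m (λ r → c m (suc r) * (H (suc r) * B (suc r)) - ι (suc r) * (c m (suc r) * B (suc r)))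
    ≡⟨ Σ-- m (λ r → c m (suc r) * (H (suc r) * B (suc r))) (λ r → ι (suc r) * (c m (suc r) * B (suc r))) ⟩
  Σ< m (λ r → c m (suc r) * (H (suc r) * B (suc r))) - V m
    -- The term of the transform at index 0 can be supplied because `H 0` = 0.
    ≡⟨ cong (_- V m) (+-identityˡ (Σ< m (λ r → c m (suc r) * (H (suc r) * B (suc r))))) ⟨
  E (λ r → H r * B r) m - V m
    ≡⟨ cong (_- V m) (E-H B m) ⟩
  H m * E B m - Σ< m (λ j → ι (m ∸ j) * E B j) - V m
    -- The summand at j = 0 is split off as `ι m * 1ℚ`, since b₀ = 1; the others form `Z`.
    ≡⟨ cong₂ (λ s t → s - t - V m) (cong₂ _*_ (H-suc p) (E-B≡b m)) (Σ-cong m (λ j _ → cong (ι (m ∸ j) *_) (E-B≡b j))) ⟩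
  (H p + ι m) * b m - (ι m * 1ℚ + Z) - V m
    ≡⟨ cong (λ t → (H p + ι m) * b m - (ι m * 1ℚ + Z) - t) V-split ⟩
  (H p + ι m) * b m - (ι m * 1ℚ + Z) - (Y + ι m * b m - (H p + ι m))
    ≡⟨ solve 5 (λ h i x y z → (h :+ i) :* x :- (i :* con 1ℚ :+ z) :- (y :+ i :* x :- (h :+ i))
                           := h :* (x :+ con 1ℚ) :- (y :+ z)) refl (H p) (ι m) (b m) Y Z ⟩
  H p * (b m + 1ℚ) - (Y + Z)
    ≡⟨ cong (λ t → H p * (b m + 1ℚ) - t) Y+Z ⟩
  H p * (b m + 1ℚ) - fromℕ m * W p ∎
  where
  m : ℕ
  m = suc p

  Y Z : ℚ
  Y = Σ< p (λ i → ι (suc i) * b (suc i))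
  Z = Σ< p (λ i → ι (p ∸ i) * b (suc i))

  term : ∀ r → u m r ≡ c m (suc r) * (H (suc r) * B (suc r)) - ι (suc r) * (c m (suc r) * B (suc r))
  term r = begin
    c m (suc r) * (B (suc r) * H r)
      ≡⟨ solve 4 (λ z x h i → z :* (x :* h) := z :* ((h :+ i) :* x) :- i :* (z :* x)) refl (c m (suc r)) (B (suc r)) (H r) (ι (suc r)) ⟩
    c m (suc r) * ((H r + ι (suc r)) * B (suc r)) - ι (suc r) * (c m (suc r) * B (suc r))
      ≡⟨ cong (λ t → c m (suc r) * (t * B (suc r)) - ι (suc r) * (c m (suc r) * B (suc r))) (H-suc r) ⟨
    c m (suc r) * (H (suc r) * B (suc r)) - ι (suc r) * (c m (suc r) * B (suc r)) ∎

  V-split : V m ≡ Y + ι m * b m - (H p + ι m)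
  V-split = begin
    V m
      ≡⟨ V-closed m ⟩
    Σ< m (λ j → ι (suc j) * (b (suc j) - 1ℚ))
      ≡⟨ Σ-cong m (λ j _ → solve 2 (λ i x → i :* (x :- con 1ℚ) := i :* x :- i) refl (ι (suc j)) (b (suc j))) ⟩
    Σ< m (λ j → ι (suc j) * b (suc j) - ι (suc j))
      ≡⟨ Σ-- m (λ j → ι (suc j) * b (suc j)) (ι ∘ suc) ⟩
    Σ< m (λ j → ι (suc j) * b (suc j)) - H m
      ≡⟨ cong₂ _-_ (Σ-last p (λ j → ι (suc j) * b (suc j))) (H-suc p) ⟩
    Y + ι m * b m - (H p + ι m) ∎

  Y+Z : Y + Z ≡ fromℕ m * W p
  Y+Z = begin
    Y + Z
      ≡⟨ Σ-+ p (λ i → ι (suc i) * b (suc i)) (λ i → ι (p ∸ i) * b (suc i)) ⟨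
    Σ< p (λ i → ι (suc i) * b (suc i) + ι (p ∸ i) * b (suc i))
      ≡⟨ Σ-cong p (λ i i<p → trans (sym (*-distribʳ-+ (b (suc i)) (ι (suc i)) (ι (p ∸ i))))
           (trans (cong (_* b (suc i)) (ι-+-complement i<p)) (*-assoc (fromℕ m) _ (b (suc i))))) ⟩
    Σ< p (λ i → fromℕ m * (ι (suc i) * ι (p ∸ i) * b (suc i)))
      ≡⟨ Σ-*ˡ p (fromℕ m) (λ i → ι (suc i) * ι (p ∸ i) * b (suc i)) ⟩
    fromℕ m * W p ∎

-- The alternating tails S n r

-- The differences in n are taken on prefix sums, because the tail S n r changes length with n.
X : ℕ → ℕ → ℚ
X n s = Σ< s (λ j → sg j * c n j * H j)

-- For s > 0 the difference of binomials is C(p,s - 1). Keeping it as a difference covers s = 0 as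
-- well, and lets `R-step` absorb each binomial separately.
δ : ℕ → ℕ → ℚ
δ p s = H s * (c (suc p) s - c p s) - ι (suc p) * c p s

-- Induction on s; the constant is the value of the complete alternating sum, as the `δ` part dies
-- for large s.
X-closed : ∀ p s → X (suc p) s ≡ - ι (suc p) - sg s * δ p s
X-closed p zero    = begin
  0ℚ
    ≡⟨ solve 1 (λ i → con 0ℚ := :- i :- con 1ℚ :* (con 0ℚ :* (con 1ℚ :- con 1ℚ) :- i :* con 1ℚ)) refl (ι (suc p)) ⟩
  - ι (suc p) - 1ℚ * (0ℚ * (1ℚ - 1ℚ) - ι (suc p) * 1ℚ)
    ≡⟨ cong (λ t → - ι (suc p) - 1ℚ * (0ℚ * (1ℚ - t) - ι (suc p) * t)) (c-0 p) ⟨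
  - ι (suc p) - 1ℚ * δ p 0 ∎
X-closed p (suc s) = begin
  X n (suc s)
    ≡⟨ Σ-last s (λ j → sg j * c n j * H j) ⟩
  X n s + sg s * c n s * H s
    ≡⟨ cong (_+ sg s * c n s * H s) (X-closed p s) ⟩
  - i - sg s * (H s * (c n s - x) - i * x) + sg s * c n s * H s
    ≡⟨ solve 6 (λ i g h z x y → :- i :- g :* (h :* (z :- x) :- i :* x) :+ g :* z :* h
                 := :- i :- con (- 1ℚ) :* g :* (h :* x :+ i :* (x :+ y) :- i :* y)) refl i (sg s) (H s) (c n s) x y ⟩
  - i - sg (suc s) * (H s * x + i * (x + y) - i * y)
    -- Absorption turns C(n,s + 1)/n into C(p,s)/(s + 1), the amount that raises `H s` to
    -- `H (suc s)` in front of `x`.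
    ≡⟨ cong (λ t → - i - sg (suc s) * (H s * x + t - i * y)) (trans (cong (i *_) (sym (c-pascal p s))) (sym (c-absorption-ι p s))) ⟩
  - i - sg (suc s) * (H s * x + ι (suc s) * x - i * y)
    ≡⟨ solve 6 (λ i g h j x y → :- i :- g :* (h :* x :+ j :* x :- i :* y)
                             := :- i :- g :* ((h :+ j) :* ((x :+ y) :- y) :- i :* y)) refl i (sg (suc s)) (H s) (ι (suc s)) x y ⟩
  - i - sg (suc s) * ((H s + ι (suc s)) * ((x + y) - y) - i * y)
    ≡⟨ cong₂ (λ h z → - i - sg (suc s) * (h * (z - y) - i * y)) (H-suc s) (c-pascal p s) ⟨
  - i - sg (suc s) * δ p (suc s) ∎
  where
  n : ℕ
  n = suc p
  i x y : ℚ
  i = ι n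
  x = c p s
  y = c p (suc s)

X-full : ∀ p → X (suc p) (suc (suc p)) ≡ - ι (suc p)
X-full p = begin
  X (suc p) s
    ≡⟨ X-closed p s ⟩
  - ι (suc p) - sg s * (H s * (c (suc p) s - c p s) - ι (suc p) * c p s)
    ≡⟨ cong₂ (λ z w → - ι (suc p) - sg s * (H s * (z - w) - ι (suc p) * w)) (c-zero (ℕ.n<1+n (suc p))) (c-zero (ℕ.m<n⇒m<1+n (ℕ.n<1+n p))) ⟩
  - ι (suc p) - sg s * (H s * (0ℚ - 0ℚ) - ι (suc p) * 0ℚ)
    ≡⟨ solve 3 (λ i g h → :- i :- g :* (h :* (con 0ℚ :- con 0ℚ) :- i :* con 0ℚ) := :- i) refl (ι (suc p)) (sg s) (H s) ⟩
  - ι (suc p) ∎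
  where
  s : ℕ
  s = suc (suc p)

-- At l = 0 truncated subtraction gives `H 0` = 0, so prefix sums may start at 0.
σ : ℕ → ℕ → ℚ
σ n l = sg l * c n l * H (l ∸ 1)

S : ℕ → ℕ → ℚ
S n r = ∑[ l ∈ r ⋯ n ] (σ n l)

S-prefix : ∀ n {i} → i ≤ n → S n (suc i) ≡ Σ< (suc n) (σ n) - Σ< (suc i) (σ n)
S-prefix n {i} i≤n = begin
  S n (suc i)
    ≡⟨ solve 2 (λ x y → x := y :+ x :- y) refl (S n (suc i)) (Σ< (suc i) (σ n)) ⟩
  Σ< (suc i) (σ n) + S n (suc i) - Σ< (suc i) (σ n)
    ≡⟨ cong (_- Σ< (suc i) (σ n)) (Σ-split (suc i) (n ∸ i) (σ n)) ⟨
  Σ< (suc i ℕ.+ (n ∸ i)) (σ n) - Σ< (suc i) (σ n)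
    ≡⟨ cong (λ k → Σ< (suc k) (σ n) - Σ< (suc i) (σ n)) (ℕ.m+[n∸m]≡n i≤n) ⟩
  Σ< (suc n) (σ n) - Σ< (suc i) (σ n) ∎

S-top : ∀ n → S (suc n) (suc n) ≡ sg (suc n) * H n
S-top n = begin
  Σ< (suc n ∸ n) (λ i → σ (suc n) (suc n ℕ.+ i))
    ≡⟨ cong (λ k → Σ< k (λ i → σ (suc n) (suc n ℕ.+ i))) (ℕ.m+n∸n≡m 1 n) ⟩
  σ (suc n) (suc n ℕ.+ 0) + 0ℚ
    ≡⟨ cong (λ k → σ (suc n) (suc k) + 0ℚ) (ℕ.+-identityʳ n) ⟩
  sg (suc n) * c (suc n) (suc n) * H n + 0ℚ
    ≡⟨ cong (λ t → sg (suc n) * t * H n + 0ℚ) (c-diagonal (suc n)) ⟩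
  sg (suc n) * 1ℚ * H n + 0ℚ
    ≡⟨ solve 2 (λ g h → g :* con 1ℚ :* h :+ con 0ℚ := g :* h) refl (sg (suc n)) (H n) ⟩
  sg (suc n) * H n ∎

-- Pascal's rule splits off C(n,l) from C(n + 1,l + 1). The index shift turns H_{l-1} into H_l and
-- flips the sign, so the extra part is minus a prefix sum `X`.
σ-prefix-step : ∀ n r → Σ< (suc r) (σ (suc n)) ≡ Σ< (suc r) (σ n) - X n r
σ-prefix-step n r = begin
  σ (suc n) 0 + Σ< r (λ l → σ (suc n) (suc l))
    ≡⟨ cong₂ _+_ (trans (*-zeroʳ (1ℚ * c (suc n) 0)) (sym (*-zeroʳ (1ℚ * c n 0)))) (Σ-cong r (λ l _ → term l)) ⟩
  σ n 0 + Σ< r (λ l → σ n (suc l) - sg l * c n l * H l)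
    ≡⟨ cong (σ n 0 +_) (Σ-- r (λ l → σ n (suc l)) (λ l → sg l * c n l * H l)) ⟩
  σ n 0 + (Σ< r (λ l → σ n (suc l)) - X n r)
    ≡⟨ +-assoc (σ n 0) (Σ< r (λ l → σ n (suc l))) (- X n r) ⟨
  Σ< (suc r) (σ n) - X n r ∎
  where
  term : ∀ l → σ (suc n) (suc l) ≡ σ n (suc l) - sg l * c n l * H l
  term l = trans (cong (λ t → sg (suc l) * t * H l) (c-pascal n l))
    (solve 4 (λ g x y h → con (- 1ℚ) :* g :* (x :+ y) :* h := con (- 1ℚ) :* g :* y :* h :- g :* x :* h) refl (sg l) (c n l) (c n (suc l)) (H l))

-- A tail is the full prefix sum minus a shorter one. Both change by an `X` containing the same
-- constant -1/n, which cancels and leaves only `δ`.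
S-step : ∀ p {i} → i ≤ suc p → S (suc (suc p)) (suc i) ≡ S (suc p) (suc i) - sg i * δ p i
S-step p {i} i≤n = begin
  S (suc n) (suc i)
    ≡⟨ S-prefix (suc n) (ℕ.m≤n⇒m≤1+n i≤n) ⟩
  Σ< (suc (suc n)) (σ (suc n)) - Σ< (suc i) (σ (suc n))
    ≡⟨ cong₂ _-_ (σ-prefix-step n (suc n)) (σ-prefix-step n i) ⟩
  (Σ< (suc (suc n)) (σ n) - X n (suc n)) - (Σ< (suc i) (σ n) - X n i)
    ≡⟨ cong₂ (λ s t → (s - t) - (Σ< (suc i) (σ n) - X n i)) last-zero (X-full p) ⟩
  (Σ< (suc n) (σ n) - (- ι n)) - (Σ< (suc i) (σ n) - X n i)
    ≡⟨ cong (λ t → (Σ< (suc n) (σ n) - (- ι n)) - (Σ< (suc i) (σ n) - t)) (X-closed p i) ⟩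
  (Σ< (suc n) (σ n) - (- ι n)) - (Σ< (suc i) (σ n) - (- ι n - sg i * δ p i))
    ≡⟨ solve 4 (λ s j t d → (s :- (:- j)) :- (t :- (:- j :- d)) := (s :- t) :- d) refl (Σ< (suc n) (σ n)) (ι n) (Σ< (suc i) (σ n)) (sg i * δ p i) ⟩
  (Σ< (suc n) (σ n) - Σ< (suc i) (σ n)) - sg i * δ p i
    ≡⟨ cong (_- sg i * δ p i) (S-prefix n i≤n) ⟨
  S n (suc i) - sg i * δ p i ∎
  where
  n : ℕ
  n = suc p

  last-zero : Σ< (suc (suc n)) (σ n) ≡ Σ< (suc n) (σ n)
  last-zero = begin
    Σ< (suc (suc n)) (σ n)
      ≡⟨ Σ-last (suc n) (σ n) ⟩
    Σ< (suc n) (σ n) + sg (suc n) * c n (suc n) * H n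
      ≡⟨ cong (λ t → Σ< (suc n) (σ n) + sg (suc n) * t * H n) (c-zero (ℕ.n<1+n n)) ⟩
    Σ< (suc n) (σ n) + sg (suc n) * 0ℚ * H n
      ≡⟨ solve 3 (λ s g h → s :+ g :* con 0ℚ :* h := s) refl (Σ< (suc n) (σ n)) (sg (suc n)) (H n) ⟩
    Σ< (suc n) (σ n) ∎

-- Recurrence for the Bernoulli sum of the tails

R : ℕ → ℚ
R n = Σ< n (λ i → ι (suc i) * b (suc i) * S n (suc i))

R-last : ∀ p → R (suc p) ≡ Σ< p (λ i → ι (suc i) * b (suc i) * S (suc p) (suc i)) + ι (suc p) * (B (suc p) * H p)
R-last p = trans (Σ-last p (λ i → ι (suc i) * b (suc i) * S (suc p) (suc i)))
  (cong (Σ< p (λ i → ι (suc i) * b (suc i) * S (suc p) (suc i)) +_) top)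
  where
  top : ι (suc p) * b (suc p) * S (suc p) (suc p) ≡ ι (suc p) * (B (suc p) * H p)
  top = begin
    ι (suc p) * b (suc p) * S (suc p) (suc p)
      ≡⟨ cong (ι (suc p) * b (suc p) *_) (S-top p) ⟩
    ι (suc p) * (sg (suc p) * B (suc p)) * (sg (suc p) * H p)
      ≡⟨ solve 4 (λ i g x h → i :* (g :* x) :* (g :* h) := g :* g :* (i :* (x :* h))) refl (ι (suc p)) (sg (suc p)) (B (suc p)) (H p) ⟩
    sg (suc p) * sg (suc p) * (ι (suc p) * (B (suc p) * H p))
      ≡⟨ cong (_* (ι (suc p) * (B (suc p) * H p))) (sg*sg (suc p)) ⟩
    1ℚ * (ι (suc p) * (B (suc p) * H p))
      ≡⟨ *-identityˡ _ ⟩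
    ι (suc p) * (B (suc p) * H p) ∎

-- Weighting `S-step` by b_r / r and absorbing 1/r into each binomial of `δ` gives summands of `U`
-- at n + 1 and at n, with constant weights, plus a sum evaluated by `Σ-cB`.
R-step : ∀ p → R (suc (suc p)) ≡ R (suc p) + (ι (suc (suc p)) * U (suc (suc p)) - ι (suc p) * U (suc p) - ι (suc p) * ι (suc p) * (b (suc p) - 1ℚ))
R-step p = begin
  R (suc n)
    ≡⟨ R-last n ⟩
  Σ< n (λ i → ι (suc i) * b (suc i) * S (suc n) (suc i)) + j * (B (suc n) * H n)
    ≡⟨ cong (_+ j * (B (suc n) * H n)) (Σ-cong n (λ i i<n → term i (ℕ.<⇒≤ i<n))) ⟩
  Σ< n (λ i → ρ i + (j * u (suc n) i - k * u n i - k * k * cB i)) + j * (B (suc n) * H n)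
    ≡⟨ cong (_+ j * (B (suc n) * H n)) Σ-terms ⟩
  R n + (j * Σ< n (u (suc n)) - k * U n - k * k * (b n - 1ℚ)) + j * (B (suc n) * H n)
    ≡⟨ solve 6 (λ r j x y z w → r :+ (j :* x :- y :- z) :+ j :* w := r :+ (j :* (x :+ con 1ℚ :* w) :- y :- z)) refl
         (R n) j (Σ< n (u (suc n))) (k * U n) (k * k * (b n - 1ℚ)) (B (suc n) * H n) ⟩
  R n + (j * (Σ< n (u (suc n)) + 1ℚ * (B (suc n) * H n)) - k * U n - k * k * (b n - 1ℚ))
    -- The summand of `R (suc n)` at r = n + 1 is the one still missing from `U (suc n)`; this is
    -- why `R` runs up to r = n.
    ≡⟨ cong (λ t → R n + (j * (Σ< n (u (suc n)) + t * (B (suc n) * H n)) - k * U n - k * k * (b n - 1ℚ))) (c-diagonal (suc n)) ⟨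
  R n + (j * (Σ< n (u (suc n)) + u (suc n) n) - k * U n - k * k * (b n - 1ℚ))
    ≡⟨ cong (λ t → R n + (j * t - k * U n - k * k * (b n - 1ℚ))) (Σ-last n (u (suc n))) ⟨
  R n + (j * U (suc n) - k * U n - k * k * (b n - 1ℚ)) ∎
  where
  n : ℕ
  n = suc p

  j k : ℚ
  j = ι (suc n)
  k = ι n

  ρ cB : ℕ → ℚ
  ρ i = ι (suc i) * b (suc i) * S n (suc i)
  cB i = c n (suc i) * B (suc i)

  term : ∀ i → i ≤ n → ι (suc i) * b (suc i) * S (suc n) (suc i) ≡ ρ i + (j * u (suc n) i - k * u n i - k * k * cB i)
  term i i≤n = begin
    ι (suc i) * b (suc i) * S (suc n) (suc i)
      ≡⟨ cong (ι (suc i) * b (suc i) *_) (S-step p i≤n) ⟩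
    ι (suc i) * (- 1ℚ * sg i * B (suc i)) * (S n (suc i) - sg i * (H i * (c n i - c p i) - k * c p i))
      -- The sign of b at i + 1 is opposite to `sg i`, so the subtracted `δ` contributes with a plus
      -- sign and the factor `sg i * sg i` = 1.
      ≡⟨ solve 8 (λ m g x s h y z k → m :* (con (- 1ℚ) :* g :* x) :* (s :- g :* (h :* (y :- z) :- k :* z))
                   := m :* (con (- 1ℚ) :* g :* x) :* s :+ g :* g :* (m :* y :* (x :* h) :- m :* z :* (x :* h) :- k :* (m :* z :* x))) refl
           (ι (suc i)) (sg i) (B (suc i)) (S n (suc i)) (H i) (c n i) (c p i) k ⟩
    ρ i + sg i * sg i * (ι (suc i) * c n i * (B (suc i) * H i) - ι (suc i) * c p i * (B (suc i) * H i) - k * (ι (suc i) * c p i * B (suc i)))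
      ≡⟨ cong (ρ i +_) (cong₂ _*_ (sg*sg i) (cong₂ (λ y z → y * (B (suc i) * H i) - z * (B (suc i) * H i) - k * (z * B (suc i)))
           (c-absorption-ι n i) (c-absorption-ι p i))) ⟩
    ρ i + 1ℚ * (j * c (suc n) (suc i) * (B (suc i) * H i) - k * c n (suc i) * (B (suc i) * H i) - k * (k * c n (suc i) * B (suc i)))
      ≡⟨ solve 7 (λ r j y w k z x → r :+ con 1ℚ :* (j :* y :* w :- k :* z :* w :- k :* (k :* z :* x))
                   := r :+ (j :* (y :* w) :- k :* (z :* w) :- k :* k :* (z :* x))) refl
           (ρ i) j (c (suc n) (suc i)) (B (suc i) * H i) k (c n (suc i)) (B (suc i)) ⟩
    ρ i + (j * u (suc n) i - k * u n i - k * k * cB i) ∎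

  Σ-terms : Σ< n (λ i → ρ i + (j * u (suc n) i - k * u n i - k * k * cB i))
          ≡ R n + (j * Σ< n (u (suc n)) - k * U n - k * k * (b n - 1ℚ))
  Σ-terms = begin
    Σ< n (λ i → ρ i + (j * u (suc n) i - k * u n i - k * k * cB i))
      ≡⟨ Σ-+ n ρ (λ i → j * u (suc n) i - k * u n i - k * k * cB i) ⟩
    R n + Σ< n (λ i → j * u (suc n) i - k * u n i - k * k * cB i)
      ≡⟨ cong (R n +_) (trans (Σ-- n (λ i → j * u (suc n) i - k * u n i) (λ i → k * k * cB i))
           (cong (_- Σ< n (λ i → k * k * cB i)) (Σ-- n (λ i → j * u (suc n) i) (λ i → k * u n i)))) ⟩
    R n + (Σ< n (λ i → j * u (suc n) i) - Σ< n (λ i → k * u n i) - Σ< n (λ i → k * k * cB i))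
      ≡⟨ cong (R n +_) (cong₂ _-_ (cong₂ _-_ (Σ-*ˡ n j (u (suc n))) (Σ-*ˡ n k (u n)))
           (trans (Σ-*ˡ n (k * k) cB) (cong (k * k *_) (Σ-cB n)))) ⟩
    R n + (j * Σ< n (u (suc n)) - k * U n - k * k * (b n - 1ℚ)) ∎

Q : ℕ → ℚ
Q p = Σ< p (λ i → ι (suc i) * ι (suc i) * b (suc i))

H⁽²⁾-suc : ∀ p → H⁽²⁾ (suc p) ≡ H⁽²⁾ p + ι (suc p) * ι (suc p)
H⁽²⁾-suc p = trans (Σ-last p (λ k → ι (suc k ℕ.^ 2))) (cong (H⁽²⁾ p +_) (ι-^2 (suc p)))

-- The terms `ι n * U n` telescope; the remaining increments (1 - b_n)/n² add up to `H⁽²⁾ p - Q p`.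
R-closed : ∀ p → R (suc p) ≡ ι (suc p) * U (suc p) + H⁽²⁾ p - Q p
R-closed zero    = refl
R-closed (suc p) = begin
  R (suc n)
    ≡⟨ R-step p ⟩
  R n + (j * U (suc n) - k * U n - k * k * (b n - 1ℚ))
    ≡⟨ cong (_+ (j * U (suc n) - k * U n - k * k * (b n - 1ℚ))) (R-closed p) ⟩
  k * U n + H⁽²⁾ p - Q p + (j * U (suc n) - k * U n - k * k * (b n - 1ℚ))
    ≡⟨ solve 6 (λ x h q y k z → x :+ h :- q :+ (y :- x :- k :* k :* (z :- con 1ℚ)) := y :+ (h :+ k :* k) :- (q :+ k :* k :* z)) refl
         (k * U n) (H⁽²⁾ p) (Q p) (j * U (suc n)) k (b n) ⟩
  j * U (suc n) + (H⁽²⁾ p + k * k) - (Q p + k * k * b n)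
    ≡⟨ cong₂ (λ s t → j * U (suc n) + s - t) (H⁽²⁾-suc p) (Σ-last p (λ i → ι (suc i) * ι (suc i) * b (suc i))) ⟨
  j * U (suc n) + H⁽²⁾ n - Q n ∎
  where
  n : ℕ
  n = suc p
  j k : ℚ
  j = ι (suc n)
  k = ι n

-- Assembly of the identity

tˢ*H : ∀ p → tˢ (suc p) * H p ≡ 0ℚ
tˢ*H zero    = refl
tˢ*H (suc p) = *-zeroˡ (H (suc p))

mainTheorem1 : (n : ℕ) → .{{_ : NonZero n}} →
    ∑[ r ∈ 1 ⋯ n ∸ 1 ] (((- 1ℚ) ^ r * B r) /ⁿ r * ((1ℚ /ⁿ n) * ∑[ l ∈ r ⋯ n ] ((- 1ℚ) ^ l * fromℕ (n C l) * H (l ∸ 1)) + 1ℚ /ⁿ (r ℕ.* (n ∸ r))))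
    ≡ H⁽²⁾ (n ∸ 1) /ⁿ n + H (n ∸ 1) /ⁿ (n ℕ.^ 2)
mainTheorem1 (suc p) = begin
  Σ< p (λ i → b (suc i) /ⁿ suc i * (k * S n (suc i) + ι (suc i ℕ.* (p ∸ i))))
    ≡⟨ Σ-cong p term ⟩
  Σ< p (λ i → k * (ρ i + (q i + w i)))
    ≡⟨ trans (Σ-*ˡ p k (λ i → ρ i + (q i + w i)))
         (cong (k *_) (trans (Σ-+ p ρ (λ i → q i + w i)) (cong (Σ< p ρ +_) (Σ-+ p q w)))) ⟩
  k * (Σ< p ρ + (Q p + W p))
    -- The summand of `R n` at r = n, which the theorem's sum lacks, is added and subtracted so that
    -- `R-closed` applies.
    ≡⟨ solve 5 (λ k x y z t → k :* (x :+ (y :+ z)) := k :* ((x :+ t) :- t :+ (y :+ z))) refl k (Σ< p ρ) (Q p) (W p) (k * (B n * H p)) ⟩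
  k * ((Σ< p ρ + k * (B n * H p)) - k * (B n * H p) + (Q p + W p))
    ≡⟨ cong (λ t → k * (t - k * (B n * H p) + (Q p + W p))) (trans (sym (R-last p)) (R-closed p)) ⟩
  k * ((k * U n + H⁽²⁾ p - Q p) - k * (B n * H p) + (Q p + W p))
    ≡⟨ cong (λ t → k * ((k * t + H⁽²⁾ p - Q p) - k * (B n * H p) + (Q p + W p))) (U-closed p) ⟩
  k * ((k * (H p * (b n + 1ℚ) - fromℕ n * W p) + H⁽²⁾ p - Q p) - k * (B n * H p) + (Q p + W p))
    ≡⟨ cong (λ t → k * ((k * (H p * (t + 1ℚ) - fromℕ n * W p) + H⁽²⁾ p - Q p) - k * (B n * H p) + (Q p + W p))) (b≡B+t n) ⟩
  k * ((k * (H p * (B n + tˢ n + 1ℚ) - fromℕ n * W p) + H⁽²⁾ p - Q p) - k * (B n * H p) + (Q p + W p))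
    -- `Q p` and the `B n` terms cancel outright. The `W p` terms cancel only through n · (1/n) = 1,
    -- which the ring solver does not know, so the factor `1ℚ - fromℕ n * k` is kept for the next
    -- step.
    ≡⟨ solve 8 (λ k h x t m w g q → k :* ((k :* (h :* (x :+ t :+ con 1ℚ) :- m :* w) :+ g :- q) :- k :* (x :* h) :+ (q :+ w))
                 := g :* k :+ h :* (k :* k) :+ (k :* k :* (t :* h) :+ k :* w :* (con 1ℚ :- m :* k))) refl
         k (H p) (B n) (tˢ n) (fromℕ n) (W p) (H⁽²⁾ p) (Q p) ⟩
  H⁽²⁾ p * k + H p * (k * k) + (k * k * (tˢ n * H p) + k * W p * (1ℚ - fromℕ n * k))
    ≡⟨ cong₂ (λ s t → H⁽²⁾ p * k + H p * (k * k) + (k * k * s + k * W p * (1ℚ - t))) (tˢ*H p) (ι-inverse n) ⟩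
  H⁽²⁾ p * k + H p * (k * k) + (k * k * 0ℚ + k * W p * (1ℚ - 1ℚ))
    ≡⟨ solve 4 (λ x y k w → x :+ y :+ (k :* k :* con 0ℚ :+ k :* w :* (con 1ℚ :- con 1ℚ)) := x :+ y) refl (H⁽²⁾ p * k) (H p * (k * k)) k (W p) ⟩
  H⁽²⁾ p * k + H p * (k * k)
    ≡⟨ cong₂ _+_ (/ⁿ-ι (H⁽²⁾ p) n) (trans (/ⁿ-ι (H p) (n ℕ.^ 2)) (cong (H p *_) (ι-^2 n))) ⟨
  H⁽²⁾ p /ⁿ n + H p /ⁿ (n ℕ.^ 2) ∎
  where
  n : ℕ
  n = suc p

  k : ℚ
  k = ι n

  ρ q w : ℕ → ℚ
  ρ i = ι (suc i) * b (suc i) * S n (suc i)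
  q i = ι (suc i) * ι (suc i) * b (suc i)
  w i = ι (suc i) * ι (p ∸ i) * b (suc i)

  -- Brings out the factor 1/n that the theorem's first summand also has; the 1/r part then yields
  -- `Q p` and the 1/(n - r) part yields `W p`.
  complement : ∀ {i} → i < p → ι (suc i) * ι (p ∸ i) ≡ k * (ι (suc i) + ι (p ∸ i))
  complement {i} i<p = begin
    x                     ≡⟨ *-identityˡ x ⟨
    1ℚ * x                ≡⟨ cong (_* x) (ι-inverse n) ⟨
    fromℕ n * k * x       ≡⟨ solve 3 (λ m k x → m :* k :* x := k :* (m :* x)) refl (fromℕ n) k x ⟩
    k * (fromℕ n * x)     ≡⟨ cong (k *_) (ι-+-complement i<p) ⟨
    k * (ι (suc i) + ι (p ∸ i)) ∎
    where
    x : ℚ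
    x = ι (suc i) * ι (p ∸ i)

  term : ∀ i → i < p → b (suc i) /ⁿ suc i * (k * S n (suc i) + ι (suc i ℕ.* (p ∸ i))) ≡ k * (ρ i + (q i + w i))
  term i i<p = begin
    b (suc i) /ⁿ suc i * (k * S n (suc i) + ι (suc i ℕ.* (p ∸ i)))
      ≡⟨ cong₂ (λ s t → s * (k * S n (suc i) + t)) (/ⁿ-ι (b (suc i)) (suc i)) (trans (ι-* (suc i) (p ∸ i)) (complement i<p)) ⟩
    b (suc i) * ι (suc i) * (k * S n (suc i) + k * (ι (suc i) + ι (p ∸ i)))
      ≡⟨ solve 5 (λ x i k s j → x :* i :* (k :* s :+ k :* (i :+ j)) := k :* (i :* x :* s :+ (i :* i :* x :+ i :* j :* x))) refl
           (b (suc i)) (ι (suc i)) k (S n (suc i)) (ι (p ∸ i)) ⟩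
    k * (ρ i + (q i + w i)) ∎
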